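{- For every $K_3N$ $n=pqr$, $A<3H-\sqrt{\dfrac H2}$.
   Context: A $K_3N$ (Korselt number with three factors) is an integer $n$ together with a factorisation $n=pqr$, where $1<p<q<r$ are odd integers (not necessarily prime) such that each of $p-1,\ q-1,\ r-1$ divides $n-1$, and such that $E:=\dfrac{pq-1}{r-1}$ (which is an integer by the divisibility condition) satisfies $E\ge 2$. Put $H:=\gcd(p-1,q-1,r-1)$ and $A:=\frac{p-1}{H}$. -}

module Defs where

open import Data.Integer.Base using (+_)
open import Data.Nat.Base as ℕ using (ℕ)
import Data.Nat.Properties as ℕ
open import Data.Nat.Divisibility using (_∣_; _∤_; ∣m+n∣m⇒∣n; divides)
open import Data.Nat.GCD using (gcd; gcd[m,n]≢0)
open import Data.Product.Base using (_×_; _,_; ∃; ∃-syntax)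
open import Data.Rational.Base hiding (_⊔_; _⊓_)
open import Data.Rational.Properties
open import Data.Rational.Solver using (module +-*-Solver)
open import Data.Sum.Base using (_⊎_; inj₁; inj₂)
open import Relation.Binary.PropositionalEquality
open import Relation.Nullary using (¬_; yes; no)

-- Dedekind reals: a real x is a two-sided located cut:
-- `L q` means q < x and `U q` means x < q.

record ℝ : Set₁ where
  field
    L U         : ℚ → Set
    L-inhabited : ∃ L
    U-inhabited : ∃ U
    L-closed    : ∀ {p q} → p < q → L q → L p
    U-closed    : ∀ {p q} → p < q → U p → U q
    L-open      : ∀ {p} → L p → ∃[ q ] p < q × L q
    U-open      : ∀ {q} → U q → ∃[ p ] p < q × U p
    disjoint    : ∀ {q} → L q → ¬ U q
    located     : ∀ {p q} → p < q → L p ⊎ U q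

infix 4 _<ℝ_

_<ℝ_ : ℝ → ℝ → Set
x <ℝ y = ∃[ q ] ℝ.U x q × ℝ.L y q

private
  x-1<x : ∀ x → x - 1ℚ < x
  x-1<x x = subst (x - 1ℚ <_) (+-identityʳ x)
              (+-monoʳ-< x {y = 0ℚ} (negative⁻¹ (- 1ℚ)))

  x<x+1 : ∀ x → x < x + 1ℚ
  x<x+1 x = subst (_< x + 1ℚ) (+-identityʳ x)
              (+-monoʳ-< x {x = 0ℚ} (positive⁻¹ 1ℚ))

fromℚ : ℚ → ℝ
fromℚ x = record
  { L           = _< x
  ; U           = x <_
  ; L-inhabited = x - 1ℚ , x-1<x x
  ; U-inhabited = x + 1ℚ , x<x+1 x
  ; L-closed    = <-trans
  ; U-closed    = λ p<q x<p → <-trans x<p p<q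
  ; L-open      = <-dense
  ; U-open      = λ x<q → let p , x<p , p<q = <-dense x<q in p , p<q , x<p
  ; disjoint    = <-asym
  ; located     = loc
  }
  where
  loc : ∀ {p q} → p < q → p < x ⊎ x < q
  loc {p} p<q with p <? x
  ... | yes p<x = inj₁ p<x
  ... | no  p≮x = inj₂ (≤-<-trans (≮⇒≥ p≮x) p<q)

private
  −-anti : ∀ x {p q} → p < q → x - q < x - p
  −-anti x p<q = +-monoʳ-< x (neg-antimono-< p<q)

  x-[x-q] : ∀ x q → x - (x - q) ≡ q
  x-[x-q] = solve 2 (λ x q → x :- (x :- q) := q) refl
    where open +-*-Solver

  x-s<q : ∀ x {q s} → x - q < s → x - s < q
  x-s<q x {q} {s} lt = subst (x - s <_) (x-[x-q] x q) (−-anti x lt)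

  q<x-s : ∀ x {q s} → s < x - q → q < x - s
  q<x-s x {q} {s} lt = subst (_< x - s) (x-[x-q] x q) (−-anti x lt)

infixl 6 _⊖_

-- The difference of a rational and a real: q < x − y iff y < x − q, and
-- dually.
_⊖_ : ℚ → ℝ → ℝ
x ⊖ y = record
  { L           = λ q → Y.U (x - q)
  ; U           = λ q → Y.L (x - q)
  ; L-inhabited = let u , Uu = Y.U-inhabited in
                  x - u , subst Y.U (sym (x-[x-q] x u)) Uu
  ; U-inhabited = let l , Ll = Y.L-inhabited in
                  x - l , subst Y.L (sym (x-[x-q] x l)) Ll
  ; L-closed    = λ p<q → Y.U-closed (−-anti x p<q)
  ; U-closed    = λ p<q → Y.L-closed (−-anti x p<q)
  ; L-open      = λ Up → let s , s< , Us = Y.U-open Up in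
                  x - s , q<x-s x s< , subst Y.U (sym (x-[x-q] x s)) Us
  ; U-open      = λ Lq → let s , <s , Ls = Y.L-open Lq in
                  x - s , x-s<q x <s , subst Y.L (sym (x-[x-q] x s)) Ls
  ; disjoint    = λ Uq Lq → Y.disjoint Lq Uq
  ; located     = loc
  }
  where
  module Y = ℝ y
  loc : ∀ {p q} → p < q → Y.U (x - p) ⊎ Y.L (x - q)
  loc p<q with Y.located (−-anti x p<q)
  ... | inj₁ l = inj₂ l
  ... | inj₂ u = inj₁ u

private
  <-by : ∀ x {y} d → 0ℚ < d → y ≡ x + d → x < y
  <-by x d 0<d y≡x+d = subst₂ _<_ (+-identityʳ x) (sym y≡x+d) (+-monoʳ-< x 0<d)

  0<y-x : ∀ {x y} → x < y → 0ℚ < y - x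
  0<y-x {x} {y} x<y = subst (_< y - x) (+-inverseʳ x) (+-monoˡ-< (- x) x<y)

  *-pos : ∀ {x y} → 0ℚ < x → 0ℚ < y → 0ℚ < x * y
  *-pos {x} {y} 0<x 0<y = positive⁻¹ _ {{pos*pos⇒pos x {{positive 0<x}} y {{positive 0<y}}}}

  *-nonNeg : ∀ {x y} → 0ℚ ≤ x → 0ℚ ≤ y → 0ℚ ≤ x * y
  *-nonNeg {x} {y} 0≤x 0≤y =
    nonNegative⁻¹ _ {{nonNeg*nonNeg⇒nonNeg x {{nonNegative 0≤x}} y {{nonNegative 0≤y}}}}

  square-mono : ∀ {x y} → 0ℚ ≤ x → x < y → x * x < y * y
  square-mono {x} {y} 0≤x x<y = ≤-<-trans
    (*-monoˡ-≤-nonNeg x {{nonNegative 0≤x}} (<⇒≤ x<y))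
    (*-monoˡ-<-pos y {{positive (≤-<-trans 0≤x x<y)}} x<y)

  -- For x ≥ 0, step = ((a + 1) x + a) / (x + a + 1) lies strictly between
  -- x and the other side of √a without crossing √a.
  module Step (a x : ℚ) (0≤a : 0ℚ ≤ a) (0≤x : 0ℚ ≤ x) where
    b d m : ℚ
    b = a + 1ℚ
    d = x + b
    m = b * x + a

    0<b : 0ℚ < b
    0<b = ≤-<-trans 0≤a (x<x+1 a)

    0<d : 0ℚ < d
    0<d = +-mono-≤-< 0≤x 0<b

    instance
      d-pos : Positive d
      d-pos = positive 0<d

      d≢0 : NonZero d
      d≢0 = pos⇒nonZero d

    i step : ℚ
    i    = 1/ d
    step = m * i

    0<i : 0ℚ < i
    0<i = positive⁻¹ i {{1/pos⇒pos d}}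

    i-pos : Positive i
    i-pos = positive 0<i

    ii-pos : Positive (i * i)
    ii-pos = positive (*-pos 0<i 0<i)

    di≡1 : d * i ≡ 1ℚ
    di≡1 = *-inverseʳ d

    ydi : ∀ y → (y * d) * i ≡ y
    ydi y = trans (*-assoc y d i) (trans (cong (y *_) di≡1) (*-identityʳ y))

    yddii : ∀ y → (y * (d * d)) * (i * i) ≡ y
    yddii y = trans
      (solve 3 (λ y d i → (y :* (d :* d)) :* (i :* i) := (((y :* d) :* i) :* d) :* i) refl y d i)
      (trans (ydi _) (ydi y))
      where open +-*-Solver

    sq : (m * m) * (i * i) ≡ step * step
    sq = solve 2 (λ m i → (m :* m) :* (i :* i) := (m :* i) :* (m :* i)) refl m i
      where open +-*-Solver

    0<c : 0ℚ < a * a + a + 1ℚ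
    0<c = ≤-<-trans (+-mono-≤ (*-nonNeg 0≤a 0≤a) 0≤a) (x<x+1 (a * a + a))

    m≡ : m ≡ x * d + (a - x * x)
    m≡ = solve 2 (λ a x → (a :+ con 1ℚ) :* x :+ a := x :* (x :+ (a :+ con 1ℚ)) :+ (a :- x :* x)) refl a x
      where open +-*-Solver

    xd≡ : x * d ≡ m + (x * x - a)
    xd≡ = solve 2 (λ a x → x :* (x :+ (a :+ con 1ℚ)) := ((a :+ con 1ℚ) :* x :+ a) :+ (x :* x :- a)) refl a x
      where open +-*-Solver

    add≡ : a * (d * d) ≡ m * m + (a * a + a + 1ℚ) * (a - x * x)
    add≡ = solve 2 (λ a x →
        let d = x :+ (a :+ con 1ℚ) ; m = (a :+ con 1ℚ) :* x :+ a in
        a :* (d :* d) := m :* m :+ (a :* a :+ a :+ con 1ℚ) :* (a :- x :* x)) refl a x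
      where open +-*-Solver

    mm≡ : m * m ≡ a * (d * d) + (a * a + a + 1ℚ) * (x * x - a)
    mm≡ = solve 2 (λ a x →
        let d = x :+ (a :+ con 1ℚ) ; m = (a :+ con 1ℚ) :* x :+ a in
        m :* m := a :* (d :* d) :+ (a :* a :+ a :+ con 1ℚ) :* (x :* x :- a)) refl a x
      where open +-*-Solver

    0<step : 0ℚ < x → 0ℚ < step
    0<step 0<x = *-pos (+-mono-<-≤ (*-pos 0<b 0<x) 0≤a) 0<i

    up : x * x < a → x < step × step * step < a
    up xx<a =
      subst (_< step) (ydi x)
        (*-monoˡ-<-pos i {{i-pos}} (<-by (x * d) _ (0<y-x xx<a) m≡)) ,
      subst₂ _<_ sq (yddii a)
        (*-monoˡ-<-pos (i * i) {{ii-pos}} (<-by (m * m) _ (*-pos 0<c (0<y-x xx<a)) add≡))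

    down : a < x * x → step < x × a < step * step
    down a<xx =
      subst (step <_) (ydi x)
        (*-monoˡ-<-pos i {{i-pos}} (<-by m _ (0<y-x a<xx) xd≡)) ,
      subst₂ _<_ (yddii a) sq
        (*-monoˡ-<-pos (i * i) {{ii-pos}} (<-by (a * (d * d)) _ (*-pos 0<c (0<y-x a<xx)) mm≡))

-- The nonnegative root: every negative rational is in the lower cut.
√ : (a : ℚ) → .{{NonNegative a}} → ℝ
√ a = record
  { L           = Lower
  ; U           = Upper
  ; L-inhabited = - 1ℚ , inj₁ (negative⁻¹ (- 1ℚ))
  ; U-inhabited = a + 1ℚ , 0<a+1 , a<[a+1]²
  ; L-closed    = L-cl
  ; U-closed    = λ p<q (0<p , a<pp) → <-trans 0<p p<q , <-trans a<pp (square-mono (<⇒≤ 0<p) p<q)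
  ; L-open      = L-op
  ; U-open      = U-op
  ; disjoint    = λ where
      (inj₁ q<0)  (0<q , _)  → <-asym q<0 0<q
      (inj₂ qq<a) (_ , a<qq) → <-asym qq<a a<qq
  ; located     = loc
  }
  where
  Lower Upper : ℚ → Set
  Lower q = q < 0ℚ ⊎ q * q < a
  Upper q = 0ℚ < q × a < q * q

  0≤a : 0ℚ ≤ a
  0≤a = nonNegative⁻¹ a

  0<a+1 : 0ℚ < a + 1ℚ
  0<a+1 = ≤-<-trans 0≤a (x<x+1 a)

  a<[a+1]² : a < (a + 1ℚ) * (a + 1ℚ)
  a<[a+1]² = <-by a (a * a + a + 1ℚ)
    (≤-<-trans (+-mono-≤ (*-nonNeg 0≤a 0≤a) 0≤a) (x<x+1 (a * a + a)))
    (solve 1 (λ a → (a :+ con 1ℚ) :* (a :+ con 1ℚ) := a :+ (a :* a :+ a :+ con 1ℚ)) refl a)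
    where open +-*-Solver

  L-cl : ∀ {p q} → p < q → Lower q → Lower p
  L-cl p<q (inj₁ q<0) = inj₁ (<-trans p<q q<0)
  L-cl {p} p<q (inj₂ qq<a) with p <? 0ℚ
  ... | yes p<0 = inj₁ p<0
  ... | no  p≮0 = inj₂ (<-trans (square-mono (≮⇒≥ p≮0) p<q) qq<a)

  L-op : ∀ {p} → Lower p → ∃[ q ] p < q × Lower q
  L-op (inj₁ p<0) = let q , p<q , q<0 = <-dense p<0 in q , p<q , inj₁ q<0
  L-op {p} (inj₂ pp<a) with p <? 0ℚ
  ... | yes p<0 = let q , p<q , q<0 = <-dense p<0 in q , p<q , inj₁ q<0
  ... | no  p≮0 = let open Step a p 0≤a (≮⇒≥ p≮0) ; p<s , ss<a = up pp<a in
                  step , p<s , inj₂ ss<a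

  U-op : ∀ {q} → Upper q → ∃[ p ] p < q × Upper p
  U-op {q} (0<q , a<qq) =
    let open Step a q 0≤a (<⇒≤ 0<q) ; s<q , a<ss = down a<qq in
    step , s<q , 0<step 0<q , a<ss

  loc : ∀ {p q} → p < q → Lower p ⊎ Upper q
  loc {p} p<q with p <? 0ℚ | p * p <? a
  ... | yes p<0 | _        = inj₁ (inj₁ p<0)
  ... | no  _   | yes pp<a = inj₁ (inj₂ pp<a)
  ... | no  p≮0 | no  pp≮a = inj₂
    ( ≤-<-trans (≮⇒≥ p≮0) p<q
    , ≤-<-trans (≮⇒≥ pp≮a) (square-mono (≮⇒≥ p≮0) p<q))

-- As 1 < p < q < r, every ∸ below is an honest subtraction, and the two
-- quotients _/_ on ℕ are exact: r ∸ 1 ∣ pq ∸ 1 is proved below, and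
-- H ∣ p ∸ 1 holds by definition of H.

private
  ∸1-nonZero : ∀ {m} → 1 ℕ.< m → ℕ.NonZero (m ℕ.∸ 1)
  ∸1-nonZero (ℕ.s≤s (ℕ.s≤s _)) = _

record K₃N : Set where
  field
    n p q r : ℕ
    n≡pqr   : n ≡ p ℕ.* q ℕ.* r
    1<p     : 1 ℕ.< p
    p<q     : p ℕ.< q
    q<r     : q ℕ.< r
    p-odd   : 2 ∤ p
    q-odd   : 2 ∤ q
    r-odd   : 2 ∤ r
    p-1∣n-1 : p ℕ.∸ 1 ∣ n ℕ.∸ 1
    q-1∣n-1 : q ℕ.∸ 1 ∣ n ℕ.∸ 1
    r-1∣n-1 : r ℕ.∸ 1 ∣ n ℕ.∸ 1

  r-1≢0 : ℕ.NonZero (r ℕ.∸ 1)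
  r-1≢0 = ∸1-nonZero (ℕ.<-trans 1<p (ℕ.<-trans p<q q<r))

  E : ℕ
  E = ((p ℕ.* q ℕ.∸ 1) ℕ./ (r ℕ.∸ 1)) {{r-1≢0}}

  field
    2≤E : 2 ℕ.≤ E

  r-1∣pq-1 : r ℕ.∸ 1 ∣ p ℕ.* q ℕ.∸ 1
  r-1∣pq-1 = ∣m+n∣m⇒∣n (subst (r ℕ.∸ 1 ∣_) (trans (cong (ℕ._∸ 1) n≡pqr) split) r-1∣n-1)
                       (divides (p ℕ.* q) refl)
    where
    split : p ℕ.* q ℕ.* r ℕ.∸ 1 ≡ p ℕ.* q ℕ.* (r ℕ.∸ 1) ℕ.+ (p ℕ.* q ℕ.∸ 1)
    split = begin
      p ℕ.* q ℕ.* r ℕ.∸ 1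
        ≡⟨ cong (λ t → p ℕ.* q ℕ.* t ℕ.∸ 1) (ℕ.m∸n+n≡m 1≤r) ⟨
      p ℕ.* q ℕ.* (r ℕ.∸ 1 ℕ.+ 1) ℕ.∸ 1
        ≡⟨ cong (ℕ._∸ 1) (ℕ.*-distribˡ-+ (p ℕ.* q) (r ℕ.∸ 1) 1) ⟩
      p ℕ.* q ℕ.* (r ℕ.∸ 1) ℕ.+ p ℕ.* q ℕ.* 1 ℕ.∸ 1
        ≡⟨ cong (λ t → p ℕ.* q ℕ.* (r ℕ.∸ 1) ℕ.+ t ℕ.∸ 1) (ℕ.*-identityʳ (p ℕ.* q)) ⟩
      p ℕ.* q ℕ.* (r ℕ.∸ 1) ℕ.+ p ℕ.* q ℕ.∸ 1
        ≡⟨ ℕ.+-∸-assoc (p ℕ.* q ℕ.* (r ℕ.∸ 1)) 1≤pq ⟩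
      p ℕ.* q ℕ.* (r ℕ.∸ 1) ℕ.+ (p ℕ.* q ℕ.∸ 1)
        ∎
      where
      open ≡-Reasoning
      1≤p = ℕ.<⇒≤ 1<p
      1≤q = ℕ.≤-trans 1≤p (ℕ.<⇒≤ p<q)
      1≤r = ℕ.≤-trans 1≤q (ℕ.<⇒≤ q<r)
      1≤pq = ℕ.*-mono-≤ 1≤p 1≤q

  H : ℕ
  H = gcd (gcd (p ℕ.∸ 1) (q ℕ.∸ 1)) (r ℕ.∸ 1)

  H≢0 : ℕ.NonZero H
  H≢0 = ℕ.≢-nonZero (gcd[m,n]≢0 (gcd (p ℕ.∸ 1) (q ℕ.∸ 1)) (r ℕ.∸ 1)
                       (inj₂ (ℕ.≢-nonZero⁻¹ (r ℕ.∸ 1) {{r-1≢0}})))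

  A : ℕ
  A = ((p ℕ.∸ 1) ℕ./ H) {{H≢0}}

{-# OPTIONS --safe #-}
module Submission where

-- Write p = HA + 1, q = HB + 1, r = HC + 1.  The divisibility conditions make
-- A, B, C pairwise coprime divisors of H(AB + BC + CA) + A + B + C, so this
-- number is m·ABC; as A < B < C it is below 3H·BC, whence mA < 3H, which is
-- more than enough for m ≥ 2.  For m = 1 put D = 3H − A, B = A + s, C = A + u:
-- the equation becomes su·N + (s + u)·K = R with N, K, R polynomials in H, D.
-- If H ≥ 2D², then N, K ≥ 0; the left side is below R for s + u ≤ 3D (by
-- 4su ≤ (s + u)²) and above R for s + u > 3D (by su ≥ s + u − 1), apart from
-- six pairs (D, H) which a finite search excludes.

open import Defs
open import Data.Empty using (⊥-elim)
open import Data.Integer.Base using (+_)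
import Data.Integer.Base as ℤ
import Data.Integer.Properties as ℤ
import Data.Nat.Base as ℕ
open import Data.Nat.Base using (ℕ; suc; NonZero; _+_; _*_; _∸_; _≤_; _<_; z≤n; s≤s)
open import Data.Nat.Coprimality using (Coprime; coprime-divisor)
open import Data.Nat.Divisibility
open import Data.Nat.DivMod using (m*[n/m]≡n)
open import Data.Nat.GCD using (gcd; gcd[m,n]∣m; gcd[m,n]∣n; gcd-greatest)
open import Data.Nat.Properties
open import Data.Nat.Solver using (module +-*-Solver)
open import Data.Product.Base using (_×_; _,_; ∃-syntax)
open import Data.Rational.Base using (ℚ; _/_; toℚᵘ)
import Data.Rational.Base as ℚ
import Data.Rational.Properties as ℚ
open import Data.Rational.Properties using (normalize-nonNeg)
import Data.Rational.Solver
import Data.Rational.Unnormalised.Base as ℚᵘ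
import Data.Rational.Unnormalised.Properties as ℚᵘ
open import Relation.Binary.PropositionalEquality
open import Relation.Nullary using (Dec; yes; no)
open import Relation.Nullary.Decidable using (True; toWitness; ¬?; _→-dec_)

open +-*-Solver using (solve; Polynomial; con; _:+_; _:*_; _:=_)

module ℚS = Data.Rational.Solver.+-*-Solver

-- Divisibility: one equation from the three Korselt conditions

-- Here e₁, e₂ are the elementary symmetric polynomials of A, B, C: expanding n = (HA + 1)(HB +
-- 1)(HC + 1) gives (n - 1)/H = H²·ABC + He₂ + e₁.
He₂+e₁ : ℕ → ℕ → ℕ → ℕ → ℕ
He₂+e₁ H A B C = H * (A * B + B * C + C * A) + (A + B + C)

-- n - 1 is a multiple of HA plus (HB + 1)(HC + 1) - 1 = H(HBC + B + C); the common factor H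
-- cancels.
korselt-∣ : ∀ {H A B C} .{{_ : NonZero H}} →
            H * A ∣ (H * A + 1) * (H * B + 1) * (H * C + 1) ∸ 1 → A ∣ H * (B * C) + (B + C)
korselt-∣ {H} {A} {B} {C} HA∣ = ∣m+n∣m⇒∣n (*-cancelˡ-∣ H (subst (H * A ∣_) split HA∣)) (m∣m*n _)
  where
  split : (H * A + 1) * (H * B + 1) * (H * C + 1) ∸ 1
        ≡ H * (A * ((H * B + 1) * (H * C + 1)) + (H * (B * C) + (B + C)))
  split = cong (_∸ 1) (solve 4 (λ H A B C →
    (H :* A :+ con 1) :* (H :* B :+ con 1) :* (H :* C :+ con 1) :=
    con 1 :+ H :* (A :* ((H :* B :+ con 1) :* (H :* C :+ con 1)) :+ (H :* (B :* C) :+ (B :+ C))))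
    refl H A B C)

∣He₂+e₁ : ∀ {H A B C} → A ∣ H * (B * C) + (B + C) → A ∣ He₂+e₁ H A B C
∣He₂+e₁ {H} {A} {B} {C} A∣ = subst (A ∣_) (sym split) (∣m∣n⇒∣m+n (m∣m*n (H * B + H * C + 1)) A∣)
  where
  split : He₂+e₁ H A B C ≡ A * (H * B + H * C + 1) + (H * (B * C) + (B + C))
  split = solve 4 (λ H A B C →
    H :* (A :* B :+ B :* C :+ C :* A) :+ (A :+ B :+ C) :=
    A :* (H :* B :+ H :* C :+ con 1) :+ (H :* (B :* C) :+ (B :+ C))) refl H A B C

He₂+e₁-rotate : ∀ H A B C → He₂+e₁ H A B C ≡ He₂+e₁ H B C A
He₂+e₁-rotate = solve 4 (λ H A B C →
  H :* (A :* B :+ B :* C :+ C :* A) :+ (A :+ B :+ C) :=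
  H :* (B :* C :+ C :* A :+ A :* B) :+ (B :+ C :+ A)) refl

-- Modulo `d` both HBC and B vanish, leaving C. This upgrades joint coprimality of A, B, C to
-- pairwise coprimality.
∣-third : ∀ {d H A B C} → A ∣ H * (B * C) + (B + C) → d ∣ A → d ∣ B → d ∣ C
∣-third {d} {H} {A} {B} {C} A∣ d∣A d∣B =
  ∣m+n∣m⇒∣n (∣m+n∣m⇒∣n (∣-trans d∣A A∣) (∣n⇒∣m*n H (∣m⇒∣m*n C d∣B))) d∣B

product-∣ : ∀ {A B C n} → Coprime A B → Coprime B C → Coprime C A →
            A ∣ n → B ∣ n → C ∣ n → ∃[ m ] n ≡ m * (A * B * C)
product-∣ {A} {B} {C} {n} AB BC CA A∣n (divides k n≡kB) C∣n
  with coprime-divisor {o = k} AB (subst (A ∣_) (trans n≡kB (*-comm k B)) A∣n)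
... | divides j k≡jA
  -- `C` is coprime to `B` and to `A`, so the two are stripped from n = B(Aj) in turn.
  with coprime-divisor {o = j} CA (coprime-divisor {o = A * j} (λ (x , y) → BC (y , x)) (subst (C ∣_) n≡BAj C∣n))
  where
  n≡BAj : n ≡ B * (A * j)
  n≡BAj = trans n≡kB (trans (cong (_* B) k≡jA) (solve 3 (λ j A B → j :* A :* B := B :* (A :* j)) refl j A B))
... | divides m j≡mC = m , (begin
  n               ≡⟨ n≡kB ⟩
  k * B           ≡⟨ cong (_* B) k≡jA ⟩
  j * A * B       ≡⟨ cong (λ t → t * A * B) j≡mC ⟩
  m * C * A * B   ≡⟨ solve 4 (λ m A B C → m :* C :* A :* B := m :* (A :* B :* C)) refl m A B C ⟩
  m * (A * B * C) ∎)
  where open ≡-Reasoning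

-- Size: an upper bound for mA

mA<3H : ∀ {H A B C m} .{{_ : NonZero H}} → A < B → B < C → He₂+e₁ H A B C ≡ m * (A * B * C) → m * A < 3 * H
mA<3H {H} {A} {B} {C} {m} A<B B<C eq with m≤n⇒∃[o]m+o≡n A<B | m≤n⇒∃[o]m+o≡n B<C
... | b , refl | c , refl = *-cancelʳ-< (B * C) (m * A) (3 * H) (begin-strict
  m * A * (B * C)   ≡⟨ solve 4 (λ m A B C → m :* A :* (B :* C) := m :* (A :* B :* C)) refl m A B C ⟩
  m * (A * B * C)   ≡⟨ eq ⟨
  He₂+e₁ H A B C    <⟨ +-monoʳ-< (H * (A * B + B * C + C * A)) A+B+C<G ⟩
  H * (A * B + B * C + C * A) + G     ≤⟨ +-monoʳ-≤ (H * (A * B + B * C + C * A)) (m≤n*m G H) ⟩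
  H * (A * B + B * C + C * A) + H * G     ≡⟨ solve 4 (λ H A b c →
    let B = con 1 :+ A :+ b ; C = con 1 :+ B :+ c in
    H :* (A :* B :+ B :* C :+ C :* A) :+ H :* (B :* (con 2 :+ b :+ c) :+ C :* (con 1 :+ b)) :=
    con 3 :* H :* (B :* C)) refl H A b c ⟩
  3 * H * (B * C)   ∎)
  where
  open ≤-Reasoning
  -- `G` is B(C - A) + C(B - A) = 3BC - e₂; since e₁ < G ≤ HG, the sum He₂ + e₁ stays below 3H·BC.
  G : ℕ
  G = B * (2 + b + c) + C * (1 + b)

  A+B+C<G : A + B + C < G
  A+B+C<G = begin-strict
    A + B + C     <⟨ +-monoˡ-< C (+-monoˡ-< B A<B) ⟩
    B + B + C     ≡⟨ solve 2 (λ B C → B :+ B :+ C := B :* con 2 :+ C :* con 1) refl B C ⟩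
    B * 2 + C * 1 ≤⟨ +-mono-≤ (*-monoʳ-≤ B (m≤m+n 2 (b + c))) (*-monoʳ-≤ C (m≤m+n 1 b)) ⟩
    G             ∎

-- The case m = 1: an equation for s = B - A and u = C - A

-- With D = d + 1 and H = 2D² + h: A = 3H − D, N = 2H − D, K = 3H² − 1 − 4HD + D²
-- and R = 9H + 9H²D − 3D − 6HD² + D³, written without subtraction, over a
-- general carrier so that they serve both as numbers and as solver syntax.
module Coefficients {S : Set} (_⊕_ _⊛_ : S → S → S) (lit : ℕ → S) (d h : S) where
  private
    infixl 6 _+′_
    infixl 7 _*′_
    _+′_ _*′_ : S → S → S
    _+′_ = _⊕_
    _*′_ = _⊛_

  D H A N K R : S
  D = lit 1 +′ d
  H = lit 2 *′ (D *′ D) +′ h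
  A = D *′ (lit 6 *′ d +′ lit 5) +′ lit 3 *′ h
  N = D *′ (lit 4 *′ d +′ lit 3) +′ lit 2 *′ h
  K = lit 4 *′ D *′ D *′ D *′ (lit 3 *′ d +′ lit 1) +′ d *′ (d +′ lit 2)
      +′ lit 4 *′ D *′ h *′ (lit 3 *′ d +′ lit 2) +′ lit 3 *′ h *′ h
  R = lit 12 *′ D *′ D *′ D *′ D *′ (lit 3 *′ d +′ lit 2) +′ D *′ D *′ D
      +′ lit 3 *′ D *′ (lit 6 *′ d +′ lit 5)
      +′ h *′ (lit 9 +′ lit 6 *′ D *′ D *′ (lit 6 *′ d +′ lit 5)) +′ lit 9 *′ D *′ h *′ h

private
  module Num (d h : ℕ) = Coefficients _+_ _*_ (λ n → n) d h
  module Poly {n} (d h : Polynomial n) = Coefficients _:+_ _:*_ con d h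
    renaming (D to D′; H to H′; A to A′; N to N′; K to K′; R to R′)

NoSolution : ℕ → ℕ → ℕ → Set
NoSolution N K R = ∀ {s u} → 0 < s → s < u → s * u * N + (s + u) * K ≢ R

NoSolutionBelow : ℕ → ℕ → ℕ → ℕ → Set
NoSolutionBelow v N K R = ∀ {u} → u < v → ∀ {s} → s < u → 0 < s → s * u * N + (s + u) * K ≢ R

noSolutionBelow? : ∀ v N K R → Dec (NoSolutionBelow v N K R)
noSolutionBelow? v N K R =
  allUpTo? (λ u → allUpTo? (λ s → 0 <? s →-dec ¬? (s * u * N + (s + u) * K ≟ R)) u) v

-- A solution has uK ≤ (s + u)K ≤ R, so `R < v * K` confines the search to u < v.
no-solution-by-search : ∀ v {N K R} → R < v * K → NoSolutionBelow v N K R → NoSolution N K R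
no-solution-by-search v {N} {K} {R} R<vK none {s} {u} 0<s s<u eq with u <? v
... | yes u<v = none u<v s<u 0<s eq
... | no  u≮v = <⇒≢ (<-≤-trans R<vK (≤-trans (*-monoˡ-≤ K (≤-trans (≮⇒≥ u≮v) (m≤n+m u s)))
                                            (m≤n+m _ (s * u * N)))) (sym eq)

module _ (d h : ℕ) where
  open Num d h

  A+D≡3H : A + D ≡ 3 * H
  A+D≡3H = solve 2 (λ d h → let open Poly d h in A′ :+ D′ := con 3 :* H′) refl d h

  -- Expanding ABC - (He₂ + e₁) in s and u yields the coefficients N = A - H, K = A² - 2AH - 1 and
  -- the constant term -R with R = A²D + 3A.
  reduced-equation : ∀ s u → He₂+e₁ H A (A + s) (A + u) ≡ A * (A + s) * (A + u) →
                     s * u * N + (s + u) * K ≡ R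
  reduced-equation s u eq = sym (+-cancelˡ-≡ (A * (A + s) * (A + u)) R _ (trans
    (solve 4 (λ d h s u → let open Poly d h ; B′ = A′ :+ s ; C′ = A′ :+ u in
      A′ :* B′ :* C′ :+ R′ :=
      H′ :* (A′ :* B′ :+ B′ :* C′ :+ C′ :* A′) :+ (A′ :+ B′ :+ C′) :+ (s :* u :* N′ :+ (s :+ u) :* K′)) refl d h s u)
    (cong (_+ (s * u * N + (s + u) * K)) eq)))

  -- The threshold 3D comes from the leading terms in H: K is about 3H² and R about 9H²D.
  below : ∀ {s u} → s ≤ u → s + u ≤ 3 * D → s * u * N + (s + u) * K < R
  below {s} {u} s≤u S≤3D = *-cancelˡ-< 4 _ R (begin-strict
    4 * (s * u * N + (s + u) * K)
      ≡⟨ solve 4 (λ s u N K → con 4 :* (s :* u :* N :+ (s :+ u) :* K)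
                            := con 4 :* (s :* u) :* N :+ con 4 :* ((s :+ u) :* K)) refl s u N K ⟩
    4 * (s * u) * N + 4 * ((s + u) * K)
      ≤⟨ +-mono-≤ (*-monoˡ-≤ N (≤-trans (4su≤[s+u]² s≤u) (*-mono-≤ S≤3D S≤3D)))
                  (*-monoʳ-≤ 4 (*-monoˡ-≤ K S≤3D)) ⟩
    3 * D * (3 * D) * N + 4 * (3 * D * K)
      -- The added term is exactly 4R - 9D²N - 12DK.
      <⟨ m<m+n _ (s≤s z≤n) ⟩
    3 * D * (3 * D) * N + 4 * (3 * D * K) + (D * D * D + (6 * (H * (D * D)) + 36 * H))
      ≡⟨ solve 2 (λ d h → let open Poly d h in
           con 3 :* D′ :* (con 3 :* D′) :* N′ :+ con 4 :* (con 3 :* D′ :* K′)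
           :+ (D′ :* D′ :* D′ :+ (con 6 :* (H′ :* (D′ :* D′)) :+ con 36 :* H′)) := con 4 :* R′) refl d h ⟩
    4 * R ∎)
    where
    open ≤-Reasoning
    4su≤[s+u]² : ∀ {s u} → s ≤ u → 4 * (s * u) ≤ (s + u) * (s + u)
    4su≤[s+u]² {s} s≤u with m≤n⇒∃[o]m+o≡n s≤u
    ... | v , refl = ≤-trans (m≤m+n _ (v * v)) (≤-reflexive
      (solve 2 (λ s v → con 4 :* (s :* (s :+ v)) :+ v :* v := (s :+ (s :+ v)) :* (s :+ (s :+ v))) refl s v))

  -- Integrality: a sum above 3D is at least 3D + 1, and su - (s + u - 1) = (s - 1)(u - 1) ≥ 0 then
  -- gives su ≥ 3D.
  above : R < 3 * D * N + suc (3 * D) * K → ∀ {s u} → 0 < s → 0 < u → 3 * D < s + u →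
          R < s * u * N + (s + u) * K
  above R< {suc s} {suc u} _ _ 3D<S = <-≤-trans R<
    (+-mono-≤ (*-monoˡ-≤ N (≤-trans (≤-pred 3D<S) S-1≤P)) (*-monoˡ-≤ K 3D<S))
    where
    S-1≤P : s + suc u ≤ suc s * suc u
    S-1≤P = ≤-trans (m≤m+n _ (s * u)) (≤-reflexive
      (solve 2 (λ s u → s :+ (con 1 :+ u) :+ s :* u := (con 1 :+ s) :* (con 1 :+ u)) refl s u))

  no-solution : R < 3 * D * N + suc (3 * D) * K → NoSolution N K R
  no-solution R< {s} {u} 0<s s<u eq with s + u ≤? 3 * D
  ... | yes S≤3D = <⇒≢ (below (<⇒≤ s<u) S≤3D) eq
  ... | no  S≰3D = <⇒≢ (above R< 0<s (<-trans 0<s s<u) (≰⇒> S≰3D)) (sym eq)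

  -- The hypothesis is 3DN + (3D + 1)K - R > 0 with its terms sorted by sign. The leading part of
  -- this difference is 3H(H - 2D²) = 3Hh, which explains the threshold H ≥ 2D².
  no-solution-large : 20 * (D * D) + 1 + 9 * h < 6 * (D * D * D) + h * (6 * (D * D) + 2 * D) + 3 * (h * h) →
                      NoSolution N K R
  no-solution-large lt = no-solution (+-cancelʳ-< _ R _ (subst (_< L + plus) L+minus≡R+plus (+-monoʳ-< L lt)))
    where
    L minus plus : ℕ
    L     = 3 * D * N + suc (3 * D) * K
    minus = 20 * (D * D) + 1 + 9 * h
    plus  = 6 * (D * D * D) + h * (6 * (D * D) + 2 * D) + 3 * (h * h)

    L+minus≡R+plus : L + minus ≡ R + plus
    L+minus≡R+plus = solve 2 (λ d h → let open Poly d h in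
      con 3 :* D′ :* N′ :+ (con 1 :+ con 3 :* D′) :* K′ :+ (con 20 :* (D′ :* D′) :+ con 1 :+ con 9 :* h) :=
      R′ :+ (con 6 :* (D′ :* D′ :* D′) :+ h :* (con 6 :* (D′ :* D′) :+ con 2 :* D′) :+ con 3 :* (h :* h)))
      refl d h

  -- Meant for (D, H) = (1,2), (1,3), (1,4), (2,8), (2,9), (3,18): 11 is the least v with R < vK in
  -- all six. Both conditions are decided by evaluation.
  no-solution-small : {_ : True (R <? 11 * K)} {_ : True (noSolutionBelow? 11 N K R)} → NoSolution N K R
  no-solution-small {R<} {none} = no-solution-by-search 11 (toWitness R<) (toWitness none)

<-by-excess : ∀ {a b} c → a + suc c ≡ b → a < b
<-by-excess {a} c eq = subst (a <_) eq (m<m+n a (s≤s z≤n))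

private
  excess : ∀ {n} → (d h g : Polynomial n) → Polynomial n × Polynomial n
  excess d h g =
    con 20 :* (D′ :* D′) :+ con 1 :+ con 9 :* h :+ (con 1 :+ g) :=
    con 6 :* (D′ :* D′ :* D′) :+ h :* (con 6 :* (D′ :* D′) :+ con 2 :* D′) :+ con 3 :* (h :* h)
    where open Poly d h

-- The hypothesis of `no-solution-large` fails only for the six small pairs. Elsewhere, shifting d
-- or h turns the difference of its sides into a polynomial with nonnegative coefficients and
-- positive constant term.
unsolvable : ∀ d h → let open Num d h in NoSolution N K R
unsolvable 0 0 = no-solution-small 0 0
unsolvable 0 1 = no-solution-small 0 1
unsolvable 0 2 = no-solution-small 0 2
unsolvable 0 (suc (suc (suc h))) = no-solution-large 0 (3 + h) (<-by-excess (8 + (17 * h + 3 * (h * h)))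
  (solve 1 (λ h → excess (con 0) (con 3 :+ h) (con 8 :+ (con 17 :* h :+ con 3 :* (h :* h)))) refl h))
unsolvable 1 0 = no-solution-small 1 0
unsolvable 1 1 = no-solution-small 1 1
unsolvable 1 (suc (suc h)) = no-solution-large 1 (2 + h) (<-by-excess (16 + (31 * h + 3 * (h * h)))
  (solve 1 (λ h → excess (con 1) (con 2 :+ h) (con 16 :+ (con 31 :* h :+ con 3 :* (h :* h)))) refl h))
unsolvable 2 0 = no-solution-small 2 0
unsolvable 2 (suc h) = no-solution-large 2 (1 + h) (<-by-excess (34 + (57 * h + 3 * (h * h)))
  (solve 1 (λ h → excess (con 2) (con 1 :+ h) (con 34 :+ (con 57 :* h :+ con 3 :* (h :* h)))) refl h))
unsolvable (suc (suc (suc k))) h = no-solution-large (3 + k) h (<-by-excess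
  (62 + (128 * k + 52 * (k * k) + 6 * (k * k * k) + h * (95 + 50 * k + 6 * (k * k)) + 3 * (h * h)))
  (solve 2 (λ k h → excess (con 3 :+ k) h
    (con 62 :+ (con 128 :* k :+ con 52 :* (k :* k) :+ con 6 :* (k :* k :* k)
               :+ h :* (con 95 :+ con 50 :* k :+ con 6 :* (k :* k)) :+ con 3 :* (h :* h)))) refl k h))

-- The bound in natural numbers

-- The conclusion is A < 3H - √(H/2) without root or subtraction: D = 3H - A exceeds √(H/2) iff H <
-- 2D².
bound : ∀ {H A B C} m .{{_ : NonZero H}} → A < B → B < C → He₂+e₁ H A B C ≡ m * (A * B * C) →
        ∃[ D ] A + D ≡ 3 * H × H < 2 * (D * D)
bound {H} {A} {B} {C} 0 A<B B<C eq =
  ⊥-elim (m<n⇒n≢0 B<C (m+n≡0⇒n≡0 (A + B) (m+n≡0⇒n≡0 (H * (A * B + B * C + C * A)) eq)))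
bound {H} {A} {B} {C} 1 A<B B<C eq
  with m≤n⇒∃[o]m+o≡n (subst (_< 3 * H) (*-identityˡ A) (mA<3H {m = 1} A<B B<C eq))
... | d , sA+d≡3H with H <? 2 * (suc d * suc d)
... | yes H<2DD = suc d , trans (+-suc A d) sA+d≡3H , H<2DD
... | no  H≮2DD with m≤n⇒∃[o]m+o≡n (≮⇒≥ H≮2DD)
-- Both `A` and `Num.A d h` equal 3H - D; identifying them makes `unsolvable` applicable.
... | h , refl with +-cancelʳ-≡ (suc d) A (Num.A d h) (trans (trans (+-suc A d) sA+d≡3H) (sym (A+D≡3H d h)))
... | refl with m≤n⇒∃[o]m+o≡n (<⇒≤ A<B) | m≤n⇒∃[o]m+o≡n (<⇒≤ (<-trans A<B B<C))
... | s , refl | u , refl = ⊥-elim (unsolvable d h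
  (+-cancelˡ-< A 0 s (subst (_< A + s) (sym (+-identityʳ A)) A<B))
  (+-cancelˡ-< A s u B<C)
  (reduced-equation d h s u (trans eq (*-identityˡ _))))
bound {H} {A} {B} {C} m@(suc (suc n)) A<B B<C eq = D , A+D≡3H′ , H<2DD
  where
  D : ℕ
  D = 3 * H ∸ A

  2A<3H : 2 * A < 3 * H
  2A<3H = ≤-<-trans (*-monoˡ-≤ A (s≤s (s≤s (z≤n {n})))) (mA<3H {m = m} A<B B<C eq)

  A+D≡3H′ : A + D ≡ 3 * H
  A+D≡3H′ = m+[n∸m]≡n (≤-trans (m≤m+n A (A + 0)) (<⇒≤ 2A<3H))

  3H<2D : 3 * H < 2 * D
  3H<2D = +-cancelˡ-< (3 * H) (3 * H) (2 * D) (begin-strict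
    3 * H + 3 * H ≡⟨ cong₂ _+_ A+D≡3H′ A+D≡3H′ ⟨
    A + D + (A + D) ≡⟨ solve 2 (λ A D → A :+ D :+ (A :+ D) := con 2 :* A :+ con 2 :* D) refl A D ⟩
    2 * A + 2 * D <⟨ +-monoˡ-< (2 * D) 2A<3H ⟩
    3 * H + 2 * D ∎)
    where open ≤-Reasoning

  n≤n² : ∀ n → n ≤ n * n
  n≤n² 0       = z≤n
  n≤n² (suc n) = m≤m*n (suc n) (suc n)

  H<2DD : H < 2 * (D * D)
  H<2DD = <-≤-trans (≤-<-trans (m≤n*m H 3) 3H<2D) (*-monoʳ-≤ 2 (n≤n² D))

-- Application to a Korselt number n = pqr

module _ (T : K₃N) where
  open K₃N T

  private instance
    _ = H≢0

  private
    H∣p-1 : H ∣ p ∸ 1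
    H∣p-1 = ∣-trans (gcd[m,n]∣m _ (r ∸ 1)) (gcd[m,n]∣m (p ∸ 1) (q ∸ 1))

    H∣q-1 : H ∣ q ∸ 1
    H∣q-1 = ∣-trans (gcd[m,n]∣m _ (r ∸ 1)) (gcd[m,n]∣n (p ∸ 1) (q ∸ 1))

    H∣r-1 : H ∣ r ∸ 1
    H∣r-1 = gcd[m,n]∣n (gcd (p ∸ 1) (q ∸ 1)) (r ∸ 1)

    B C : ℕ
    B = (q ∸ 1) ℕ./ H
    C = (r ∸ 1) ℕ./ H

    HA≡p-1 : H * A ≡ p ∸ 1
    HA≡p-1 = m*[n/m]≡n H∣p-1

    HB≡q-1 : H * B ≡ q ∸ 1
    HB≡q-1 = m*[n/m]≡n H∣q-1

    HC≡r-1 : H * C ≡ r ∸ 1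
    HC≡r-1 = m*[n/m]≡n H∣r-1

    1<q : 1 < q
    1<q = <-trans 1<p p<q

    HA+1≡p : H * A + 1 ≡ p
    HA+1≡p = trans (cong (_+ 1) HA≡p-1) (m∸n+n≡m (<⇒≤ 1<p))

    HB+1≡q : H * B + 1 ≡ q
    HB+1≡q = trans (cong (_+ 1) HB≡q-1) (m∸n+n≡m (<⇒≤ 1<q))

    HC+1≡r : H * C + 1 ≡ r
    HC+1≡r = trans (cong (_+ 1) HC≡r-1) (m∸n+n≡m (<⇒≤ (<-trans 1<q q<r)))

    A<B : A < B
    A<B = *-cancelˡ-< H A B (+-cancelʳ-< 1 _ _ (subst₂ _<_ (sym HA+1≡p) (sym HB+1≡q) p<q))

    B<C : B < C
    B<C = *-cancelˡ-< H B C (+-cancelʳ-< 1 _ _ (subst₂ _<_ (sym HB+1≡q) (sym HC+1≡r) q<r))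

    n≡ : n ≡ (H * A + 1) * (H * B + 1) * (H * C + 1)
    n≡ = trans n≡pqr (sym (cong₂ _*_ (cong₂ _*_ HA+1≡p HB+1≡q) HC+1≡r))

    rotate : ∀ a b c → a * b * c ≡ b * c * a
    rotate a b c = trans (*-assoc a b c) (*-comm a (b * c))

    A∣ : A ∣ H * (B * C) + (B + C)
    A∣ = korselt-∣ (subst₂ (λ x y → x ∣ y ∸ 1) (sym HA≡p-1) n≡ p-1∣n-1)

    B∣ : B ∣ H * (C * A) + (C + A)
    B∣ = korselt-∣ (subst₂ (λ x y → x ∣ y ∸ 1) (sym HB≡q-1) (trans n≡ (rotate (H * A + 1) _ _)) q-1∣n-1)

    C∣ : C ∣ H * (A * B) + (A + B)
    C∣ = korselt-∣ (subst₂ (λ x y → x ∣ y ∸ 1) (sym HC≡r-1)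
           (trans n≡ (sym (rotate (H * C + 1) (H * A + 1) (H * B + 1)))) r-1∣n-1)

    -- Hd divides p - 1, q - 1 and r - 1, hence their gcd H.
    common-divisor : ∀ {d} → d ∣ A → d ∣ B → d ∣ C → d ≡ 1
    common-divisor {d} d∣A d∣B d∣C = ∣1⇒≡1 (*-cancelˡ-∣ H (subst (H * d ∣_) (sym (*-identityʳ H))
      (gcd-greatest (gcd-greatest (lift HA≡p-1 d∣A) (lift HB≡q-1 d∣B)) (lift HC≡r-1 d∣C))))
      where
      lift : ∀ {x y} → H * x ≡ y → d ∣ x → H * d ∣ y
      lift Hx≡y d∣x = subst (H * d ∣_) Hx≡y (*-monoʳ-∣ H d∣x)

  natural-bound : ∃[ D ] A + D ≡ 3 * H × H < 2 * (D * D)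
  natural-bound = let m , eq = product-∣
                        (λ (a , b) → common-divisor a b (∣-third {H = H} A∣ a b))
                        (λ (b , c) → common-divisor (∣-third {H = H} B∣ b c) b c)
                        (λ (c , a) → common-divisor a (∣-third {H = H} C∣ c a) c)
                        (∣He₂+e₁ {H} A∣)
                        (subst (B ∣_) (sym (He₂+e₁-rotate H A B C)) (∣He₂+e₁ {H} B∣))
                        (subst (C ∣_) (He₂+e₁-rotate H C A B) (∣He₂+e₁ {H} C∣))
                  in bound m A<B B<C eq

-- Passage to rationals and real cuts

half<square : ∀ H D → H < 2 * (D * D) → + H / 2 ℚ.< (+ D / 1) ℚ.* (+ D / 1)
half<square H D H<2DD = ℚ.toℚᵘ-cancel-< (begin-strict
  -- The second argument of `ℚᵘ.mkℚᵘ` is the denominator minus one, so `ℚᵘ.mkℚᵘ (+ H) 1` is H/2.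
  toℚᵘ (+ H / 2)                           ≃⟨ ℚ.toℚᵘ-fromℚᵘ (ℚᵘ.mkℚᵘ (+ H) 1) ⟩
  ℚᵘ.mkℚᵘ (+ H) 1                          <⟨ ℚᵘ.*<* (subst₂ ℤ._<_ (ℤ.pos-* H 1) DD2 (ℤ.+<+ H*1<DD2)) ⟩
  D/1 ℚᵘ.* D/1                             ≃⟨ ℚᵘ.*-cong (ℚ.toℚᵘ-fromℚᵘ D/1) (ℚ.toℚᵘ-fromℚᵘ D/1) ⟨
  toℚᵘ (+ D / 1) ℚᵘ.* toℚᵘ (+ D / 1)       ≃⟨ ℚ.toℚᵘ-homo-* (+ D / 1) (+ D / 1) ⟨
  toℚᵘ ((+ D / 1) ℚ.* (+ D / 1))           ∎)
  where
  open ℚᵘ.≤-Reasoning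
  D/1 = ℚᵘ.mkℚᵘ (+ D) 0

  DD2 : + (D * D * 2) ≡ + D ℤ.* + D ℤ.* + 2
  DD2 = trans (ℤ.pos-* (D * D) 2) (cong (ℤ._* + 2) (ℤ.pos-* D D))

  H*1<DD2 : H * 1 < D * D * 2
  H*1<DD2 = subst₂ _<_ (sym (*-identityʳ H)) (*-comm 2 (D * D)) H<2DD

+-/1 : ∀ m n → + (m + n) / 1 ≡ (+ m / 1) ℚ.+ (+ n / 1)
+-/1 m n = ℚ.toℚᵘ-injective (begin-equality
  toℚᵘ (+ (m + n) / 1)                     ≃⟨ ℚ.toℚᵘ-fromℚᵘ (ℚᵘ.mkℚᵘ (+ (m + n)) 0) ⟩
  ℚᵘ.mkℚᵘ (+ (m + n)) 0                    ≃⟨ ℚᵘ.*≡* m+n≡ ⟩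
  m/1 ℚᵘ.+ n/1                             ≃⟨ ℚᵘ.+-cong (ℚ.toℚᵘ-fromℚᵘ m/1) (ℚ.toℚᵘ-fromℚᵘ n/1) ⟨
  toℚᵘ (+ m / 1) ℚᵘ.+ toℚᵘ (+ n / 1)       ≃⟨ ℚ.toℚᵘ-homo-+ (+ m / 1) (+ n / 1) ⟨
  toℚᵘ ((+ m / 1) ℚ.+ (+ n / 1))           ∎)
  where
  open ℚᵘ.≤-Reasoning
  m/1 = ℚᵘ.mkℚᵘ (+ m) 0
  n/1 = ℚᵘ.mkℚᵘ (+ n) 0

  m+n≡ : + (m + n) ℤ.* + 1 ≡ (+ m ℤ.* + 1 ℤ.+ + n ℤ.* + 1) ℤ.* + 1
  m+n≡ = cong (ℤ._* + 1) (sym (cong₂ ℤ._+_ (ℤ.*-identityʳ (+ m)) (ℤ.*-identityʳ (+ n))))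

-- Openness of the upper cut yields s with z < s < y, and x - s separates a = x - y from x - z.
<ℝ-⊖ : ∀ {a x y} (z : ℝ) → ℝ.U z y → a ℚ.+ y ≡ x → fromℚ a <ℝ x ⊖ z
<ℝ-⊖ {a} {x} {y} z Uy a+y≡x with ℝ.U-open z Uy
... | s , s<y , Us = x ℚ.- s ,
  subst (ℚ._< x ℚ.- s) x-y≡a (ℚ.+-monoʳ-< x (ℚ.neg-antimono-< s<y)) ,
  subst (ℝ.U z) (sym (x-[x-s]≡s x s)) Us
  where
  x-[x-s]≡s : ∀ x s → x ℚ.- (x ℚ.- s) ≡ s
  x-[x-s]≡s = ℚS.solve 2 (λ x s → x ℚS.:- (x ℚS.:- s) ℚS.:= s) refl

  x-y≡a : x ℚ.- y ≡ a
  x-y≡a = trans (cong (ℚ._- y) (sym a+y≡x)) (ℚS.solve 2 (λ a y → a ℚS.:+ y ℚS.:- y ℚS.:= a) refl a y)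

0<n/1 : ∀ n .{{_ : NonZero n}} → ℚ.0ℚ ℚ.< + n / 1
0<n/1 n = ℚ.positive⁻¹ (+ n / 1) {{ℚ.normalize-pos n 1}}

<-3H-√[H/2] : ∀ {A H} → ∃[ D ] A + D ≡ 3 * H × H < 2 * (D * D) →
              fromℚ (+ A / 1) <ℝ (+ (3 * H) / 1) ⊖ √ (+ H / 2) {{normalize-nonNeg H 2}}
-- D = 0 is absurd, as it would give H < 0; the upper cut of the root asks for 0 < D besides H/2 <
-- D².
<-3H-√[H/2] {A} {H} (D@(suc _) , A+D≡3H , H<2DD) =
  <ℝ-⊖ (√ (+ H / 2) {{normalize-nonNeg H 2}}) (0<n/1 D , half<square H D H<2DD)
    (trans (sym (+-/1 A D)) (cong (λ t → + t / 1) A+D≡3H))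

theorem4p1 : (N : K₃N) → let open K₃N N in
    fromℚ (+ A / 1) <ℝ (+ (3 * H) / 1) ⊖ √ (+ H / 2) {{normalize-nonNeg H 2}}
theorem4p1 T = <-3H-√[H/2] (natural-bound T)
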